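{- Termination semantics is compositional for cool stateful SOS specifications. That is, let $\mathcal L$ be a cool stateful SOS specification over a signature $\Sigma$ and a countable set $S$ of states, and for programs $p,q\in\mu\Sigma$ write $p\approx q$ if $p$ and $q$ have the same termination semantics. Then for every $n$-ary operator $\mathsf f\in\Sigma$ and all programs $p_i,q_i\in\mu\Sigma$ ($i=1,\dots,n$), if $p_i\approx q_i$ for $i=1,\dots,n$, then $\mathsf f(p_1,\dots,p_n)\approx\mathsf f(q_1,\dots,q_n)$.
   Context: **Signature and terms.** $\Sigma$ is an algebraic signature (operation symbols $\mathsf f$ with arities in $\mathbb N$), $\Sigma^\star X$ is the set of $\Sigma$-terms with variables from $X$, and $\mu\Sigma=\Sigma^\star\emptyset$ is the set of closed terms (programs). $\mathcal V=\{x_1,x_2,\dots\}\cup\{y_1,y_2,\dots\}$ is a countably infinite set of variables. $1=\{*\}$. **Specifications.** A progressing literal is $s,p\to s',q$ and a terminating literal is $s,p\downarrow s'$ (also written $s,p\to s',*$), with $s,s'\in S$, $p,q\in\Sigma^\star\mathcal V$ (input $s$, source $p$, output $s'$, target $q$). A stateful SOS rule for an $n$-ary $\mathsf f$ is an expression $l_1\dots l_n/L$ of literals (premisses $l_j$, conclusion $L$) with the same input $s$, such that the source of $l_j$ is $x_j$, its target is $y_j$ if it is progressing, the source of $L$ is $\mathsf f(x_1,\dots,x_n)$, and if $L$ is progressing all variables of its target appear as source or target of some premiss. The rule is progressing/terminating if $L$ is. Its trigger is $(s,(s_1',\mathtt c_1),\dots,(s_n',\mathtt c_n))$, where $s_j'$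 is the output of $l_j$ and $\mathtt c_j=\mathtt{pr}$ or $\mathtt{te}$ according to whether $l_j$ is progressing or terminating. A stateful SOS specification is a set of rules containing, for each $n$-ary $\mathsf f$ and each $(s,(s_1',\mathtt c_1),\dots,(s_n',\mathtt c_n))$ with $s,s_j'\in S$, $\mathtt c_j\in\{\mathtt{pr},\mathtt{te}\}$, exactly one rule for $\mathsf f$ with that trigger. Convention: a rule written with some premisses omitted stands for the set of all rules obtained by filling in the missing premisses in any possible way (so the conclusion does not depend on the omitted premisses). **Transition function.** $\gamma_0\colon S\times\mu\Sigma\to S\times(\mu\Sigma+1)$ is defined by induction on programs: for $p=\mathsf f(t_1,\dots,t_n)$ let $(s_j',w_j)=\gamma_0(s,t_j)$, and take the unique rule for $\mathsf f$ with trigger $(s,(s_1',\mathtt c_1),\dots,(s_n',\mathtt c_n))$, where $\mathtt c_j=\mathtt{te}$ if $w_j=*$ and $\mathtt c_j=\mathtt{pr}$ otherwise; with $s'$ the output of its conclusion, $\gamma_0(s,p)=(s',*)$ if the rule is terminating, and otherwise $\gamma_0(s,p)=(s',t')$, where $t'$ is the target of the conclusion with $x_j$ replaced by $t_j$ and $y_j$ by $w_j$. Write $s,p\to s',p'$ if $\gamma_0(s,p)=(s',p')$, and $s,p\downarrow s'$ if $\gamma_0(s,p)=(s',*)$. **Termination semantics.** For $p\in\mu\Sigma$ and $s\in S$, let $\llbracket p\rrbracket_{\mathcal L}(s)\in S^++S^\omega$ be the possibly terminating sequence of states $s_1s_2s_3\cdots$ computed by $p$ on input $s$: $s,p\to s_1,p_1\to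 s_2,p_2\to\cdots$; if some step is terminating, $s_{k-1},p_{k-1}\downarrow s_k$, the sequence is $s_1\cdots s_k$. The termination semantics is the map $\mu\Sigma\to(S+\{\bot\})^S$ sending $p$ and $s$ to the last state of $\llbracket p\rrbracket_{\mathcal L}(s)$ if this sequence is finite, and to $\bot$ otherwise. **Passive/active operators.** An $n$-ary operator $\mathsf f$ is passive if all rules for $\mathsf f$ are of the form $\dfrac{}{s,\mathsf f(x_1,\dots,x_n)\to s',t}$ (all premisses omitted) with $t\in\Sigma^\star(\{x_1,\dots,x_n\})$ or $t=*$; i.e. for each input $s$ the output $s'$ and target $t$ (or termination) are the same for all choices of premisses. Otherwise $\mathsf f$ is active. **Cool.** A stateful SOS specification is cool if for every active operator $\mathsf f$ of arity $n$ there exists $j\in\{1,\dots,n\}$ such that: (1) all rules for $\mathsf f$ whose $j$-th premiss is progressing are of the form $\dfrac{s,x_j\to s',y_j}{s,\mathsf f(x_1,\dots,x_n)\to s',\mathsf f(x_1,\dots,x_n)[y_j/x_j]}$ (all premisses but the $j$-th omitted), with $[u/x]$ denoting substitution of the variable $x$ by the term $u$; (2) all rules for $\mathsf f$ whose $j$-th premiss is terminating are of the form $\dfrac{s,x_j\downarrow s'}{s,\mathsf f(x_1,\dots,x_n)\to s'',t}$ (all premisses but the $j$-th omitted) where $t\in\Sigma^\star(\{x_1,\dots,x_n\}\smallsetminus\{x_j\})$ or $t=*$, and moreover $s''$ and $t$ depend only on $s'$ but not on $s$. -}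

module Defs where

open import Level using (Level; _⊔_) renaming (suc to lsuc)
open import Axiom.ExcludedMiddle using (ExcludedMiddle)
open import Data.Empty using (⊥)
open import Data.Fin.Base using (Fin)
open import Data.List.NonEmpty.Base using (List⁺; [_]; _∷⁺_; last)
open import Data.Maybe.Base using (Maybe; just; nothing)
import Data.Maybe.Base as Maybe
open import Data.Nat.Base using (ℕ; zero; suc)
open import Data.Product.Base using (Σ-syntax; ∃-syntax; _×_; _,_; proj₁; proj₂)
open import Data.Product using (∃!)
open import Data.Sum.Base using (_⊎_; inj₁; inj₂; [_,_]′)
open import Data.Vec.Base using (Vec; []; _∷_; lookup; map; tabulate; _[_]≔_)
open import Data.Vec.Properties using (lookup-map)
open import Function.Base using (_∘_; const)
open import Relation.Binary.PropositionalEquality using (_≡_; _≢_; sym; trans; cong)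
open import Relation.Nullary using (¬_; yes; no)

record Signature (o : Level) : Set (lsuc o) where
  field
    Op    : Set o
    arity : Op → ℕ

open Signature public

data Term {o x : Level} (Sg : Signature o) (X : Set x) : Set (o ⊔ x) where
  var : X → Term Sg X
  op  : (f : Op Sg) → Vec (Term Sg X) (arity Sg f) → Term Sg X

Program : {o : Level} → Signature o → Set o
Program Sg = Term Sg ⊥

module _ {o x y : Level} {Sg : Signature o} {X : Set x} {Y : Set y} where

  subst  : (X → Term Sg Y) → Term Sg X → Term Sg Y
  subst* : {n : ℕ} → (X → Term Sg Y) → Vec (Term Sg X) n → Vec (Term Sg Y) n

  subst σ (var v)   = σ v
  subst σ (op f ts) = op f (subst* σ ts)

  subst* σ []       = []
  subst* σ (t ∷ ts) = subst σ t ∷ subst* σ ts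

  rename : (X → Y) → Term Sg X → Term Sg Y
  rename ρ = subst (var ∘ ρ)

-- Throughout, the summand 1 = {*} (termination) is the `nothing` of Maybe.

data Kind : Set where
  pr te : Kind

kind : {a : Level} {A : Set a} → Maybe A → Kind
kind (just _) = pr
kind nothing  = te

-- A premiss (s′ , pr) at position j is the literal  s,xⱼ → s′,yⱼ  and
-- (s′ , te) is  s,xⱼ ↓ s′,  where s is the common input of the rule: source
-- and target of a premiss are determined by its position.
Premisses : {s : Level} → Set s → ℕ → Set s
Premisses S n = Vec (S × Kind) n

-- The variables occurring as source or target of some premiss.
data RuleVar {s : Level} {S : Set s} {n : ℕ} (ls : Premisses S n) : Set where
  x : Fin n → RuleVar ls
  y : (j : Fin n) → proj₂ (lookup ls j) ≡ pr → RuleVar ls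

module _ {o s : Level} (Sg : Signature o) (S : Set s) where

  Trigger : Op Sg → Set s
  Trigger f = S × Premisses S (arity Sg f)

  -- Output and target of the conclusion, whose source is f(x₁,…,xₙ).
  Conclusion : {n : ℕ} → Premisses S n → Set (o ⊔ s)
  Conclusion ls = S × Maybe (Term Sg (RuleVar ls))

  -- A rule for f consists of a trigger τ, which fixes the premisses, and a
  -- conclusion c; `Rule f τ c` says that it belongs to the specification.
  record Specification : Set (lsuc (o ⊔ s)) where
    field
      Rule       : (f : Op Sg) (τ : Trigger f) → Conclusion (proj₂ τ) → Set (o ⊔ s)
      uniqueRule : (f : Op Sg) (τ : Trigger f) → ∃! _≡_ (Rule f τ)

open Specification public

module _ {o s : Level} {Sg : Signature o} {S : Set s} where

  observe : S × Maybe (Program Sg) → S × Kind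
  observe (s′ , w) = s′ , kind w

  target : (w : Maybe (Program Sg)) → kind w ≡ pr → Program Sg
  target (just p) _ = p

  -- xⱼ ↦ tⱼ and yⱼ ↦ wⱼ
  instantiate : {n : ℕ} → Vec (Program Sg) n → (ws : Vec (S × Maybe (Program Sg)) n) →
                RuleVar (map observe ws) → Program Sg
  instantiate ts ws (x j)   = lookup ts j
  instantiate ts ws (y j e) =
    target (proj₂ (lookup ws j)) (trans (sym (cong proj₂ (lookup-map j observe ws))) e)

module _ {o s : Level} {Sg : Signature o} {S : Set s} (L : Specification Sg S) where

  γ₀  : S → Program Sg → S × Maybe (Program Sg)
  γ₀* : {n : ℕ} → S → Vec (Program Sg) n → Vec (S × Maybe (Program Sg)) n

  γ₀ a (op f ts) =
    let ws             = γ₀* a ts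
        (a′ , t) , _   = uniqueRule L f (a , map observe ws)
    in  a′ , Maybe.map (subst (instantiate ts ws)) t

  γ₀* a []       = []
  γ₀* a (t ∷ ts) = γ₀ a t ∷ γ₀* a ts

  -- `Run a p w`: the run of p on input a terminates and its states form w.
  data Run (a : S) (p : Program Sg) : List⁺ S → Set (o ⊔ s) where
    stop : ∀ {a′} → γ₀ a p ≡ (a′ , nothing) → Run a p [ a′ ]
    step : ∀ {a′ p′ w} → γ₀ a p ≡ (a′ , just p′) → Run a′ p′ w → Run a p (a′ ∷⁺ w)

  -- Entry k is the (k+1)-st state of the run.  After termination the last
  -- state is repeated; this clause is irrelevant for infinite runs.
  states : S → Program Sg → ℕ → S
  states a p k with γ₀ a p
  states a p zero    | a′ , _       = a′
  states a p (suc k) | a′ , just p′ = states a′ p′ k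
  states a p (suc k) | a′ , nothing = a′

  -- Whether a run is finite is undecidable, so a function into S⁺ + S^ω
  -- needs classical logic.
  ⟦_⟧ : Program Sg → ExcludedMiddle (o ⊔ s) → S → List⁺ S ⊎ (ℕ → S)
  ⟦ p ⟧ em a with em {∃[ w ] Run a p w}
  ... | yes (w , _) = inj₁ w
  ... | no  _       = inj₂ (states a p)

  -- Here `nothing` is ⊥.
  terminationSemantics : ExcludedMiddle (o ⊔ s) → Program Sg → S → Maybe S
  terminationSemantics em p a = [ just ∘ last , const nothing ]′ (⟦ p ⟧ em a)

  SameTermination : ExcludedMiddle (o ⊔ s) → Program Sg → Program Sg → Set s
  SameTermination em p q =
    (a : S) → terminationSemantics em p a ≡ terminationSemantics em q a

  Passive : Op Sg → Set (o ⊔ s)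
  Passive f =
    (a : S) →
    Σ[ a′ ∈ S ] Σ[ t ∈ Maybe (Term Sg (Fin (arity Sg f))) ]
      (∀ ls c → Rule L f (a , ls) c → c ≡ (a′ , Maybe.map (rename x) t))

  Active : Op Sg → Set (o ⊔ s)
  Active f = ¬ Passive f

  ProgressingAt : (f : Op Sg) → Fin (arity Sg f) → Set (o ⊔ s)
  ProgressingAt f j =
    ∀ a ls c → Rule L f (a , ls) c → (e : proj₂ (lookup ls j) ≡ pr) →
    c ≡ (proj₁ (lookup ls j) , just (op f (tabulate (var ∘ x) [ j ]≔ var (y j e))))

  TerminatingAt : (f : Op Sg) → Fin (arity Sg f) → Set (o ⊔ s)
  TerminatingAt f j =
    (a′ : S) →
    Σ[ a″ ∈ S ] Σ[ t ∈ Maybe (Term Sg (Σ[ i ∈ Fin (arity Sg f) ] i ≢ j)) ]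
      (∀ a ls c → Rule L f (a , ls) c → lookup ls j ≡ (a′ , te) →
       c ≡ (a″ , Maybe.map (rename (x ∘ proj₁)) t))

  Cool : Set (o ⊔ s)
  Cool = (f : Op Sg) → Active f → ∃[ j ] (ProgressingAt f j × TerminatingAt f j)

{-# OPTIONS --safe #-}

-- Let p ≲ q mean that q reaches every final state that p reaches from the
-- same initial state.  Pointwise ≲ substitutions σ, τ satisfy t[σ] ≲ t[τ], by
-- induction on the length n of the run of t[σ] and then on t.  Let t = f(ts).
-- If f is passive, one step leads to u[ts[σ]] and u[ts[τ]] with the same u,
-- and the argument continues with n - 1, the term u, and the substitutions
-- ts[σ], ts[τ].  If f is active with receiving position j, a run of f(ts[σ])
-- consists of a complete run of tsⱼ[σ], whose last step is replaced by a step
-- to some u[ts[σ]] where u depends only on the last state reached and does not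
-- mention xⱼ; the complete run can be exchanged for one of tsⱼ[τ].
module Submission where

open import Defs
open import Level using (Level; _⊔_)
open import Axiom.ExcludedMiddle using (ExcludedMiddle)
open import Data.Fin.Base using (Fin; zero; suc)
open import Data.List.Base using (_∷_; initLast; []; _∷ʳ′_)
open import Data.List.NonEmpty.Base using (List⁺; _∷_; _∷⁺_; last)
open import Data.Maybe.Base using (Maybe; just; nothing)
import Data.Maybe.Base as Maybe
open import Data.Maybe.Properties using (just-injective)
import Data.Maybe.Properties as Maybeₚ
open import Data.Nat.Base using (ℕ; suc)
open import Data.Product.Base using (∃-syntax; _×_; _,_; proj₁; proj₂)
open import Data.Vec.Base using (Vec; []; _∷_; lookup; map; tabulate; _[_]≔_)
open import Data.Vec.Properties
  using (lookup-map; map-[]≔; tabulate-∘; tabulate∘lookup; lookup∘update; lookup∘update′)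
open import Function.Base using (_∘_)
open import Function.Bundles using (_↣_)
open import Relation.Binary.PropositionalEquality hiding (subst; [_])
import Relation.Binary.PropositionalEquality as ≡
open import Relation.Nullary using (yes; no; contradiction)

last-∷⁺ : ∀ {a} {A : Set a} (z : A) (w : List⁺ A) → last (z ∷⁺ w) ≡ last w
last-∷⁺ z (h ∷ t) with initLast t
... | []      = refl
... | _ ∷ʳ′ _ = refl

-- With `nothing` standing for divergence, this reduces equality of semantics to preservation of
-- final states in both directions, so diverging runs never have to be compared.
just-antisym : ∀ {a} {A : Set a} (m n : Maybe A) →
  (∀ {b} → m ≡ just b → n ≡ just b) → (∀ {b} → n ≡ just b → m ≡ just b) → m ≡ n
just-antisym (just _) _        to from = sym (to refl)
just-antisym nothing  (just _) to from = from refl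
just-antisym nothing  nothing  to from = refl

module _ {o u v : Level} {Sg : Signature o} {X : Set u} {Y : Set v} where

  subst-≗  : {σ τ : X → Term Sg Y} → σ ≗ τ → subst σ ≗ subst τ
  subst*-≗ : {σ τ : X → Term Sg Y} → σ ≗ τ → ∀ {n} → subst* {n = n} σ ≗ subst* τ
  subst-≗ e (var z)    = e z
  subst-≗ e (op f ts)  = cong (op f) (subst*-≗ e ts)
  subst*-≗ e []        = refl
  subst*-≗ e (t ∷ ts)  = cong₂ _∷_ (subst-≗ e t) (subst*-≗ e ts)

  subst*-map : (σ : X → Term Sg Y) → ∀ {n} (ts : Vec (Term Sg X) n) →
    subst* σ ts ≡ map (subst σ) ts
  subst*-map σ []       = refl
  subst*-map σ (t ∷ ts) = cong (subst σ t ∷_) (subst*-map σ ts)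

module _ {o u v w : Level} {Sg : Signature o} {X : Set u} {Y : Set v} {Z : Set w}
  (σ : Y → Term Sg Z) (ρ : X → Y) where

  subst-rename  : (t : Term Sg X) → subst σ (rename ρ t) ≡ subst (σ ∘ ρ) t
  subst*-rename : ∀ {n} (ts : Vec (Term Sg X) n) →
    subst* σ (subst* (var ∘ ρ) ts) ≡ subst* (σ ∘ ρ) ts
  subst-rename (var z)     = refl
  subst-rename (op f ts)   = cong (op f) (subst*-rename ts)
  subst*-rename []         = refl
  subst*-rename (t ∷ ts)   = cong₂ _∷_ (subst-rename t) (subst*-rename ts)

  map-subst-rename : (t : Maybe (Term Sg X)) →
    Maybe.map (subst σ) (Maybe.map (rename ρ) t) ≡ Maybe.map (subst (σ ∘ ρ)) t
  map-subst-rename t = trans (sym (Maybeₚ.map-∘ t)) (Maybeₚ.map-cong subst-rename t)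

target-just : ∀ {o} {Sg : Signature o} {s} {S : Set s} {w : Maybe (Program Sg)} {p} →
  w ≡ just p → (e : kind w ≡ pr) → target {S = S} w e ≡ p
target-just refl _ = refl

module _ {o s : Level} {Sg : Signature o} {S : Set s} (L : Specification Sg S) where

  private
    Config : Set (o ⊔ s)
    Config = S × Maybe (Program Sg)

  infix 4 _⇓[_]_ _⇓_

  -- The index bounds the number of steps from above; it need not be exact.
  data _⇓[_]_ : Config → ℕ → S → Set (o ⊔ s) where
    done : ∀ {a n} → (a , nothing) ⇓[ n ] a
    next : ∀ {a p n b} → γ₀ L a p ⇓[ n ] b → (a , just p) ⇓[ suc n ] b

  _⇓_ : Config → S → Set (o ⊔ s)
  c ⇓ b = ∃[ n ] c ⇓[ n ] b

  next⇓ : ∀ {a p b} → γ₀ L a p ⇓ b → (a , just p) ⇓ b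
  next⇓ (n , r) = suc n , next r

  weaken : ∀ {c n b} → c ⇓[ n ] b → c ⇓[ suc n ] b
  weaken done     = done
  weaken (next r) = next (weaken r)

  ⇓-deterministic : ∀ {c m n b b′} → c ⇓[ m ] b → c ⇓[ n ] b′ → b ≡ b′
  ⇓-deterministic done     done      = refl
  ⇓-deterministic (next r) (next r′) = ⇓-deterministic r r′

  lookup-γ₀* : ∀ {n} a (ts : Vec (Program Sg) n) j → lookup (γ₀* L a ts) j ≡ γ₀ L a (lookup ts j)
  lookup-γ₀* a (t ∷ ts) zero    = refl
  lookup-γ₀* a (t ∷ ts) (suc j) = lookup-γ₀* a ts j

  -- The last stage of `γ₀`, isolated as a function of the conclusion so that equal conclusions can
  -- be exchanged by `cong`.
  conclude : ∀ f a ts → Conclusion Sg S (map observe (γ₀* L a ts)) → Config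
  conclude f a ts (a′ , t) = a′ , Maybe.map (subst (instantiate {n = arity Sg f} ts (γ₀* L a ts))) t

  γ₀-rule : ∀ f a ts c →
    (∀ c′ → Rule L f (a , map observe (γ₀* L a ts)) c′ → c′ ≡ c) →
    γ₀ L a (op f ts) ≡ conclude f a ts c
  γ₀-rule f a ts c only = cong (conclude f a ts) (only _ (proj₁ (proj₂ (uniqueRule L f _))))

  γ₀-passive : ∀ f (passive : Passive L f) a ts →
    let a′ , t , _ = passive a
    in  γ₀ L a (op f ts) ≡ (a′ , Maybe.map (subst (lookup ts)) t)
  γ₀-passive f passive a ts with a′ , t , only ← passive a =
    trans (γ₀-rule f a ts (a′ , Maybe.map (rename x) t) (only _))
          (cong (a′ ,_) (map-subst-rename _ x t))

  lookup-observe : ∀ {n} a (ts : Vec (Program Sg) n) j →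
    lookup (map observe (γ₀* L a ts)) j ≡ observe (γ₀ L a (lookup ts j))
  lookup-observe a ts j = trans (lookup-map j observe (γ₀* L a ts)) (cong observe (lookup-γ₀* a ts j))

  γ₀-terminating : ∀ f j (T : TerminatingAt L f j) a ts {a′} →
    γ₀ L a (lookup ts j) ≡ (a′ , nothing) →
    let a″ , t , _ = T a′
    in  γ₀ L a (op f ts) ≡ (a″ , Maybe.map (subst (lookup ts ∘ proj₁)) t)
  γ₀-terminating f j T a ts {a′} eq with a″ , t , only ← T a′ =
    trans (γ₀-rule f a ts (a″ , Maybe.map (rename (x ∘ proj₁)) t)
            λ c r → only a _ c r (trans (lookup-observe a ts j) (cong observe eq)))
          (cong (a″ ,_) (map-subst-rename _ (x ∘ proj₁) t))

  γ₀-progressing : ∀ f j → ProgressingAt L f j → ∀ a ts {a′ p} →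
    γ₀ L a (lookup ts j) ≡ (a′ , just p) →
    γ₀ L a (op f ts) ≡ (a′ , just (op f (ts [ j ]≔ p)))
  γ₀-progressing f j P a ts {a′} {p} eq =
    trans (γ₀-rule f a ts _ λ c r → P a _ c r j-progresses)
          (cong₂ (λ b us → b , just (op f us)) (cong proj₁ premiss-j) arguments)
    where
    premiss-j = trans (lookup-observe a ts j) (cong observe eq)
    j-progresses = cong proj₂ premiss-j
    σ = instantiate ts (γ₀* L a ts)

    arguments : subst* σ (tabulate (var ∘ x) [ j ]≔ var (y j j-progresses)) ≡ ts [ j ]≔ p
    arguments = begin
      subst* σ (tabulate (var ∘ x) [ j ]≔ var (y j j-progresses))
        ≡⟨ subst*-map σ _ ⟩
      map (subst σ) (tabulate (var ∘ x) [ j ]≔ var (y j j-progresses))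
        ≡⟨ map-[]≔ (subst σ) _ j ⟩
      map (subst σ) (tabulate (var ∘ x)) [ j ]≔ σ (y j j-progresses)
        -- Each `x i` becomes the i-th entry of `ts`, and the target variable of premiss `j` becomes
        -- `p` by `eq`.
        ≡⟨ cong₂ (_[ j ]≔_) (trans (sym (tabulate-∘ (subst σ) (var ∘ x))) (tabulate∘lookup ts))
             (target-just {S = S} (cong proj₂ (trans (lookup-γ₀* a ts j) eq)) _) ⟩
      ts [ j ]≔ p ∎
      where open ≡-Reasoning

  module _ (f : Op Sg) (j : Fin (arity Sg f)) (P : ProgressingAt L f j) (T : TerminatingAt L f j) where

    -- The configuration that `f` enters once its j-th argument has terminated in `a′`. By coolness
    -- it does not depend on the state in which that last step starts.
    resume : Vec (Program Sg) (arity Sg f) → S → Config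
    resume ts a′ = let a″ , t , _ = T a′ in a″ , Maybe.map (subst (lookup ts ∘ proj₁)) t

    -- The term supplied by `T` omits the j-th variable. Hence the original `ts` can be kept while
    -- the j-th argument evolves.
    resume-update : ∀ ts p a′ → resume (ts [ j ]≔ p) a′ ≡ resume ts a′
    resume-update ts p a′ with a″ , t , _ ← T a′ =
      cong (a″ ,_) (Maybeₚ.map-cong (subst-≗ λ (i , i≢j) → lookup∘update′ i≢j ts p) t)

    -- The terminating step of the j-th argument coincides with the step of `f` into `resume`. So
    -- the argument's run obeys the bound of the whole run, and the remainder obeys a strictly
    -- smaller one.
    split : ∀ n a ts {b} → (a , just (op f ts)) ⇓[ suc n ] b →
      ∃[ a′ ] (a , just (lookup ts j)) ⇓[ suc n ] a′ × resume ts a′ ⇓[ n ] b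
    split n a ts (next r) with γ₀ L a (lookup ts j) in eq
    split n a ts (next r) | a′ , nothing =
      a′ , next (≡.subst (_⇓[ n ] a′) (sym eq) done) ,
      ≡.subst (_⇓[ n ] _) (γ₀-terminating f j T a ts eq) r
    split n a ts (next r) | a′ , just p
      with n | ≡.subst (_⇓[ n ] _) (γ₀-progressing f j P a ts eq) r
    -- A run from a `just` configuration has a positive bound, so `n` must be a successor.
    ... | suc m | r′ with split m a′ (ts [ j ]≔ p) r′
    ...   | a‴ , rⱼ , rest =
      a‴ ,
      next (≡.subst (_⇓[ suc m ] a‴) (sym eq)
        (≡.subst (λ q → (a′ , just q) ⇓[ suc m ] a‴) (lookup∘update j ts p) rⱼ)) ,
      weaken (≡.subst (_⇓[ m ] _) (resume-update ts p a‴) rest)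

    -- Induction on the argument's run: its progressing steps lift to steps of `f`, and its
    -- terminating step is replaced by the step into `resume`.
    join : ∀ n a ts {a′ b} → (a , just (lookup ts j)) ⇓[ n ] a′ → resume ts a′ ⇓ b →
      (a , just (op f ts)) ⇓ b
    join (suc n) a ts (next r) rest with γ₀ L a (lookup ts j) in eq
    join (suc n) a ts (next done) rest | a′ , nothing =
      next⇓ (≡.subst (_⇓ _) (sym (γ₀-terminating f j T a ts eq)) rest)
    join (suc n) a ts {a‴} (next r) rest | a′ , just p =
      next⇓ (≡.subst (_⇓ _) (sym (γ₀-progressing f j P a ts eq))
        (join n a′ (ts [ j ]≔ p)
          (≡.subst (λ q → (a′ , just q) ⇓[ n ] a‴) (sym (lookup∘update j ts p)) r)
          (≡.subst (_⇓ _) (sym (resume-update ts p a‴)) rest)))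

  infix 4 _≲[_]_

  -- Only the left run is bounded: equal semantics says nothing about lengths, so the matching run
  -- on the right may be longer.
  _≲[_]_ : Program Sg → ℕ → Program Sg → Set (o ⊔ s)
  p ≲[ n ] q = ∀ {a b} → (a , just p) ⇓[ n ] b → (a , just q) ⇓ b

  module _ (em : ExcludedMiddle (o ⊔ s)) (cool : Cool L) where

    -- Simultaneous recursion, lexicographic in the bound and the term: `subst-mono` descends in the
    -- term at fixed `n`, while `op-mono` lowers `n` before passing to a rule's target, which can be
    -- an arbitrary term.
    op-mono : ∀ n f (ps qs : Vec (Program Sg) (arity Sg f)) →
      (∀ i → lookup ps i ≲[ n ] lookup qs i) → op f ps ≲[ n ] op f qs
    subst-mono : ∀ n {ℓ} {X : Set ℓ} {σ τ : X → Program Sg} → (∀ z → σ z ≲[ n ] τ z) →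
      (t : Term Sg X) → subst σ t ≲[ n ] subst τ t
    subst*-mono : ∀ n {ℓ} {X : Set ℓ} {σ τ : X → Program Sg} → (∀ z → σ z ≲[ n ] τ z) →
      ∀ {k} (ts : Vec (Term Sg X) k) → ∀ i → lookup (subst* σ ts) i ≲[ n ] lookup (subst* τ ts) i
    map-subst-mono : ∀ n {ℓ} {X : Set ℓ} {σ τ : X → Program Sg} → (∀ z → σ z ≲[ n ] τ z) →
      ∀ (t : Maybe (Term Sg X)) {a b} →
      (a , Maybe.map (subst σ) t) ⇓[ n ] b → (a , Maybe.map (subst τ) t) ⇓ b

    op-mono (suc n) f ps qs ps≲qs {a} {b} r with em {Passive L f}
    op-mono (suc n) f ps qs ps≲qs {a} {b} (next r) | yes passive =
      next⇓ (≡.subst (_⇓ b) (sym (γ₀-passive f passive a qs))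
        (map-subst-mono n (λ i → ps≲qs i ∘ weaken) (proj₁ (proj₂ (passive a)))
          (≡.subst (_⇓[ n ] b) (γ₀-passive f passive a ps) r)))
    ... | no active =
      let j , P , T    = cool f active
          a′ , rⱼ , r′ = split f j P T n a ps r
          -- `rⱼ` may need the full bound `suc n`, which the hypothesis covers; only `r′`, bounded
          -- by `n`, enters the recursion.
          m , rⱼ′      = ps≲qs j rⱼ
      in  join f j P T m a qs rⱼ′
            (map-subst-mono n (λ (i , _) → ps≲qs i ∘ weaken) (proj₁ (proj₂ (T a′))) r′)

    subst-mono n σ≲τ (var z)   = σ≲τ z
    subst-mono n σ≲τ (op f ts) = op-mono n f _ _ (subst*-mono n σ≲τ ts)

    subst*-mono n σ≲τ (t ∷ ts) zero    = subst-mono n σ≲τ t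
    subst*-mono n σ≲τ (t ∷ ts) (suc i) = subst*-mono n σ≲τ ts i

    map-subst-mono n σ≲τ nothing  r = n , r
    map-subst-mono n σ≲τ (just t) r = subst-mono n σ≲τ t r

  Run⇒⇓ : ∀ {a p w} → Run L a p w → (a , just p) ⇓ last w
  Run⇒⇓ (stop eq) = 1 , next (≡.subst (_⇓[ 0 ] _) (sym eq) done)
  Run⇒⇓ (step {w = w} eq r) =
    next⇓ (≡.subst₂ _⇓_ (sym eq) (sym (last-∷⁺ _ w)) (Run⇒⇓ r))

  ⇓⇒Run : ∀ n {a p b} → (a , just p) ⇓[ n ] b → ∃[ w ] Run L a p w
  ⇓⇒Run (suc n) {a} {p} (next r) with γ₀ L a p in eq
  ... | a′ , nothing = _ , stop eq
  ... | a′ , just p′ = _ , step eq (proj₂ (⇓⇒Run n r))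

  module _ (em : ExcludedMiddle (o ⊔ s)) where

    semantics⇒⇓ : ∀ p a {b} → terminationSemantics L em p a ≡ just b → (a , just p) ⇓ b
    semantics⇒⇓ p a eq with em {∃[ w ] Run L a p w}
    ... | yes (w , r) = ≡.subst (_ ⇓_) (just-injective eq) (Run⇒⇓ r)

    ⇓⇒semantics : ∀ p a {b} → (a , just p) ⇓ b → terminationSemantics L em p a ≡ just b
    ⇓⇒semantics p a (n , d) with em {∃[ w ] Run L a p w}
    -- The run found by `em` is not literally the given one; determinism identifies their final
    -- states.
    ... | yes (w , r) = cong just (⇓-deterministic (proj₂ (Run⇒⇓ r)) d)
    ... | no diverges = contradiction (⇓⇒Run n d) diverges

    op-preserves-semantics : Cool L → ∀ f (ps qs : Vec (Program Sg) (arity Sg f)) →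
      (∀ i → SameTermination L em (lookup ps i) (lookup qs i)) →
      ∀ a {b} → terminationSemantics L em (op f ps) a ≡ just b →
      terminationSemantics L em (op f qs) a ≡ just b
    op-preserves-semantics cool f ps qs ps≈qs a eq =
      let n , r = semantics⇒⇓ (op f ps) a eq
      -- Equality of semantics gives the comparison of arguments at every bound; the bound used is
      -- that of the run of `op f ps`.
      in  ⇓⇒semantics (op f qs) a (op-mono em cool n f ps qs
            (λ i {a} d → semantics⇒⇓ (lookup qs i) a
              (trans (sym (ps≈qs i a)) (⇓⇒semantics (lookup ps i) a (n , d)))) r)

theorem5p11 : {o s : Level} (em : ExcludedMiddle (o ⊔ s))
    (Sg : Signature o) (S : Set s) → S ↣ ℕ →
    (L : Specification Sg S) → Cool L →
    (f : Op Sg) (ps qs : Vec (Program Sg) (arity Sg f)) →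
    ((i : Fin (arity Sg f)) → SameTermination L em (lookup ps i) (lookup qs i)) →
    SameTermination L em (op f ps) (op f qs)
theorem5p11 em Sg S _ L cool f ps qs ps≈qs a = just-antisym _ _
  (op-preserves-semantics L em cool f ps qs ps≈qs a)
  (op-preserves-semantics L em cool f qs ps (λ i a → sym (ps≈qs i a)) a)
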